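{- Let $g$ be a positive integer. Then there exists $c=c(g)>0$ such that for every positive integer $n$ there exists a graph $G$ which is the incidence graph of $n$ points and $n$ open rectangles in $\mathbb{R}^2$, has girth at least $g$, and has at least $c\,n\log\log n$ edges.
   Context: An open rectangle is a set $(a,c)\times(b,d)\subset\mathbb{R}^2$. The incidence graph of a set $P$ of points and a set $\mathcal{R}$ of open rectangles is the bipartite graph with vertex classes $P$ and $\mathcal{R}$ in which $p\in P$ and $R\in\mathcal{R}$ are adjacent iff $p\in R$. The girth of a graph is the length of its shortest cycle. -}

module Defs where

open import Data.Nat using (ℕ; zero; suc; _+_; _*_; _≤_)
open import Data.Fin using (Fin; zero; suc; inject₁; fromℕ)
open import Data.Rational using (ℚ; _<_)
open import Data.Rational.Properties using (_<?_)
open import Data.Product using (_×_; _,_; proj₁; proj₂)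
open import Data.List using (List; length; filter; map)
open import Data.Nat.ListAction using (sum)
open import Data.List.Base using (allFin)
open import Data.Empty using (⊥)
open import Relation.Nullary using (Dec; ¬_)
open import Relation.Nullary.Decidable using (_×-dec_)
open import Relation.Binary.PropositionalEquality using (_≡_; _≢_)
open import Function.Definitions using (Injective)

Point : Set
Point = ℚ × ℚ

-- The open rectangle (a,c) × (b,d), stored by its four parameters.
record Rect : Set where
  constructor rect
  field
    a b c d : ℚ

_∈R_ : Point → Rect → Set
(x , y) ∈R rect a b c d = (a < x × x < c) × (b < y × y < d)

_∈R?_ : (p : Point) → (R : Rect) → Dec (p ∈R R)
(x , y) ∈R? rect a b c d = ((a <? x) ×-dec (x <? c)) ×-dec ((b <? y) ×-dec (y <? d))

SameSet : Rect → Rect → Set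
SameSet R S = ∀ p → (p ∈R R → p ∈R S) × (p ∈R S → p ∈R R)

record Config (n : ℕ) : Set where
  field
    pt   : Fin n → Point
    rc   : Fin n → Rect
    pt-inj : Injective _≡_ _≡_ pt
    rc-distinct : ∀ i j → i ≢ j → ¬ SameSet (rc i) (rc j)

open Config public

edges : ∀ {n} → Config n → ℕ
edges {n} C = sum (map (λ i → length (filter (λ j → pt C i ∈R? rc C j) (allFin n))) (allFin n))

-- A cycle of length 2(k+1) in the incidence graph:
--   p₀ R₀ p₁ R₁ … p_k R_k p₀  with distinct points and distinct rectangles,
-- where pᵢ ∈ Rᵢ and p_{i+1} ∈ Rᵢ (indices mod k+1).
record Cycle {n : ℕ} (C : Config n) (k : ℕ) : Set where
  field
    ps : Fin (suc k) → Fin n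
    rs : Fin (suc k) → Fin n
    ps-inj : Injective _≡_ _≡_ ps
    rs-inj : Injective _≡_ _≡_ rs
    inc-here : ∀ j → pt C (ps j) ∈R rc C (rs j)
    inc-next : ∀ (i : Fin k) → pt C (ps (suc i)) ∈R rc C (rs (inject₁ i))
    inc-close : pt C (ps zero) ∈R rc C (rs (fromℕ k))

-- Girth at least g: every cycle (of length 2(k+1), k ≥ 1) has length ≥ g.
-- (An acyclic graph has infinite girth, hence girth ≥ g.)
GirthAtLeast : ∀ {n} → Config n → ℕ → Set
GirthAtLeast C g = ∀ k → 1 ≤ k → Cycle C k → g ≤ 2 * suc k

{-# OPTIONS --safe #-}
-- Let 𝒜 be an arrangement of P points, with distinct abscissae, and at most P rectangles, in which
-- every point has degree D and the girth is large.  Stack N copies of 𝒜 in disjoint horizontal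
-- strips, and take a bipartite graph of large girth between the copies and N further vertices in
-- which every copy has degree P.  Within a copy the points may be shifted horizontally as long as
-- their order is kept, so the points of all copies can be placed such that each further vertex is
-- realised by a thin vertical strip containing exactly one point of each of its neighbours.
-- Contracting the copies maps a short cycle through a strip to one of the bipartite graph, so the
-- girth stays large, while every degree has grown to D + 1.  The bipartite graph is found greedily
-- with N polynomial in P; hence P is at most doubly exponential in D.
module Submission where

open import Defs
open import Data.Nat using (ℕ; _*_; _≤_)
open import Data.Nat.Logarithm using (⌊log₂_⌋; ⌈log₂_⌉)
open import Data.Product using (Σ; _×_)

open import Data.Empty using (⊥)
open import Data.Fin using (Fin; zero; suc; inject₁; fromℕ; fromℕ<; toℕ)
import Data.Fin.Properties as Fin
import Data.Integer as ℤ
import Data.Integer.Properties as ℤ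
open import Data.List using (List; []; _∷_; _++_; map; length; filter; concatMap; allFin; cartesianProduct)
open import Data.List.Membership.Propositional using (_∈_; _∉_)
open import Data.List.Membership.Propositional.Properties
import Data.List.Membership.DecPropositional as DecMembership
open import Data.List.Properties
  using (length-++; length-++-comm; length-++-sucʳ; length-map; length-tabulate; ++-identityʳ;
         filter-reject; map-cong-local)
open import Data.List.Relation.Unary.All as All using (All; []; _∷_)
open import Data.List.Relation.Unary.AllPairs using ([]; _∷_)
open import Data.List.Relation.Unary.Any as Any using (here; there)
open import Data.List.Relation.Unary.Unique.Propositional using (Unique)
import Data.List.Relation.Unary.Unique.Propositional.Properties as Unique
open import Data.Maybe using (Maybe; just; nothing; maybe)
open import Data.Nat
  using (zero; suc; _+_; _∸_; _^_; _<_; _≤?_; z≤n; s≤s; s≤s⁻¹; z<s; NonZero; >-nonZero)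
open import Data.Nat.Coprimality using (1-coprimeTo) renaming (sym to coprime-sym)
open import Data.Nat.DivMod using (_/_; _%_; m/n*n≤m; m≡m%n+[m/n]*n; m%n<n; m*n/n≡m; /-monoˡ-≤)
open import Data.Nat.ListAction using (sum)
open import Data.Nat.Logarithm using (⌊log₂⌋-mono-≤; ⌈log₂⌉-mono-≤; ⌊log₂[2^n]⌋≡n; ⌈log₂2^n⌉≡n)
open import Data.Nat.Properties
open import Data.Nat.Tactic.RingSolver using (solve-∀)
open import Data.Product as Product using (∃; ∃₂; _,_; proj₁; proj₂)
open import Data.Product.Function.NonDependent.Propositional using (_×-↔_)
open import Data.Product.Properties using (≡-dec; ,-injectiveʳ)
open import Data.Rational using (ℚ; mkℚ; *<*)
import Data.Rational as ℚ
open import Data.Rational.Properties using (drop-*<*)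
open import Data.Sum using (_⊎_; inj₁; inj₂; isInj₁)
open import Data.Sum.Function.Propositional using (_⊎-↔_)
import Data.Sum.Properties as Sum
open import Function using (_∘_; _↔_; Inverse; Injection)
open import Function.Construct.Composition using (_↔-∘_)
open import Function.Construct.Identity using (↔-id)
open import Function.Construct.Symmetry using (↔-sym)
open import Function.Definitions using (Injective)
open import Function.Properties.Inverse using (↔⇒↣)
open import Level using (0ℓ)
open import Relation.Binary.Definitions using (DecidableEquality)
open import Relation.Binary.PropositionalEquality
open import Relation.Nullary using (¬_; yes; no; contradiction; ¬?)
open import Relation.Nullary.Decidable using (_⊎-dec_; map′)
open import Relation.Unary using (Pred; Decidable)

-- Counting with duplicate-free lists

module _ {X : Set} where

  unique-⊆⇒length≤ : {xs ys : List X} → Unique xs → (∀ {x} → x ∈ xs → x ∈ ys) → length xs ≤ length ys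
  unique-⊆⇒length≤ {[]} [] sub = z≤n
  unique-⊆⇒length≤ {x ∷ xs} (x∉xs ∷ xs!) sub with ∈-∃++ (sub (here refl))
  ... | ys , zs , refl = subst (suc (length xs) ≤_) (sym (length-++-sucʳ ys x zs))
                               (s≤s (unique-⊆⇒length≤ xs! sub′))
    where
    sub′ : ∀ {y} → y ∈ xs → y ∈ ys ++ zs
    sub′ y∈xs with ∈-++⁻ ys (sub (there y∈xs))
    ... | inj₁ y∈ys         = ∈-++⁺ˡ y∈ys
    ... | inj₂ (here refl)  = contradiction refl (All.lookup x∉xs y∈xs)
    ... | inj₂ (there y∈zs) = ∈-++⁺ʳ ys y∈zs

  unique-middle : ∀ {x} (ys : List X) {zs} → Unique (ys ++ x ∷ zs) → x ∉ ys ++ zs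
  unique-middle []       (x∉zs ∷ _) x∈zs        = All.lookup x∉zs x∈zs refl
  unique-middle (y ∷ ys) (y∉ ∷ _)   (here refl) = All.lookup y∉ (∈-insert ys) refl
  unique-middle (y ∷ ys) (_ ∷ u)    (there x∈)  = unique-middle ys u x∈

-- Incidence graphs as lists of edges

module _ {A B : Set} where

  -- The index is a budget: `done` may leave part of it unspent, and edges may be repeated.
  data Walk (es : List (A × B)) : ℕ → A ⊎ B → A ⊎ B → Set where
    done   : ∀ {ℓ u} → Walk es ℓ u u
    across : ∀ {ℓ a b w} → (a , b) ∈ es → Walk es ℓ (inj₂ b) w → Walk es (suc ℓ) (inj₁ a) w
    back   : ∀ {ℓ a b w} → (a , b) ∈ es → Walk es ℓ (inj₁ a) w → Walk es (suc ℓ) (inj₂ b) w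

  -- The edges can be inserted one at a time, from the tail of the list to its head, such that
  -- no inserted edge joins two vertices already connected by a walk of at most g edges.
  data HighGirth (g : ℕ) : List (A × B) → Set where
    []  : HighGirth g []
    _∷_ : ∀ {a b es} → ¬ Walk es g (inj₁ a) (inj₂ b) → HighGirth g es → HighGirth g ((a , b) ∷ es)

  weaken : ∀ {es ℓ u v} → Walk es ℓ u v → Walk es (suc ℓ) u v
  weaken done         = done
  weaken (across i w) = across i (weaken w)
  weaken (back i w)   = back i (weaken w)

  -- Unlike a walk, a path records its edges, so that `Unique` can say that it is a trail and it can
  -- be cut at a given edge.
  data Path : List (A × B) → A ⊎ B → A ⊎ B → Set where
    []     : ∀ {u} → Path [] u u
    across : ∀ {L a b w} → Path L (inj₂ b) w → Path ((a , b) ∷ L) (inj₁ a) w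
    back   : ∀ {L a b w} → Path L (inj₁ a) w → Path ((a , b) ∷ L) (inj₂ b) w

  path⇒walk : ∀ {es L ℓ u v} → (∀ {e} → e ∈ L → e ∈ es) → length L ≤ ℓ → Path L u v → Walk es ℓ u v
  path⇒walk sub _       []         = done
  path⇒walk sub (s≤s l) (across p) = across (sub (here refl)) (path⇒walk (sub ∘ there) l p)
  path⇒walk sub (s≤s l) (back p)   = back (sub (here refl)) (path⇒walk (sub ∘ there) l p)

  _++ᵖ_ : ∀ {L M u v w} → Path L u v → Path M v w → Path (L ++ M) u w
  []       ++ᵖ q = q
  across p ++ᵖ q = across (p ++ᵖ q)
  back p   ++ᵖ q = back (p ++ᵖ q)

  restart : ∀ {es ℓ u u′ v} → u ≡ u′ → Walk es ℓ u′ v → Walk es ℓ u v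
  restart refl w = w

  snoc-across : ∀ {es ℓ u a b} → (a , b) ∈ es → Walk es ℓ u (inj₁ a) → Walk es (suc ℓ) u (inj₂ b)
  snoc-across i done         = across i done
  snoc-across i (across j w) = across j (snoc-across i w)
  snoc-across i (back j w)   = back j (snoc-across i w)

  snoc-back : ∀ {es ℓ u a b} → (a , b) ∈ es → Walk es ℓ u (inj₂ b) → Walk es (suc ℓ) u (inj₁ a)
  snoc-back i done         = back i done
  snoc-back i (across j w) = across j (snoc-back i w)
  snoc-back i (back j w)   = back j (snoc-back i w)

  reverse : ∀ {es ℓ u v} → Walk es ℓ u v → Walk es ℓ v u
  reverse done         = done
  reverse (across i w) = snoc-back i (reverse w)
  reverse (back i w)   = snoc-across i (reverse w)

  split : ∀ {L a b u v} → (a , b) ∈ L → Path L u v → ∃₂ λ L₁ L₂ → L ≡ L₁ ++ (a , b) ∷ L₂ ×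
          (Path L₁ u (inj₁ a) × Path L₂ (inj₂ b) v ⊎ Path L₁ u (inj₂ b) × Path L₂ (inj₁ a) v)
  split (here refl) (across p) = [] , _ , refl , inj₁ ([] , p)
  split (here refl) (back p)   = [] , _ , refl , inj₂ ([] , p)
  split (there i) (across {a = a} {b} p) with split i p
  ... | L₁ , L₂ , refl , inj₁ (q , r) = (a , b) ∷ L₁ , L₂ , refl , inj₁ (across q , r)
  ... | L₁ , L₂ , refl , inj₂ (q , r) = (a , b) ∷ L₁ , L₂ , refl , inj₂ (across q , r)
  split (there i) (back {a = a} {b} p) with split i p
  ... | L₁ , L₂ , refl , inj₁ (q , r) = (a , b) ∷ L₁ , L₂ , refl , inj₁ (back q , r)
  ... | L₁ , L₂ , refl , inj₂ (q , r) = (a , b) ∷ L₁ , L₂ , refl , inj₂ (back q , r)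

  -- The edge of a closed trail that was inserted last would join the two ends of the rest of the trail.
  no-closed-trail : ∀ {g es L u} → HighGirth g es → Unique L → (∀ {e} → e ∈ L → e ∈ es) →
                    Path L u u → 1 ≤ length L → length L ≤ suc g → ⊥
  no-closed-trail {L = _ ∷ _} [] L! sub p 1≤ ≤g with () ← sub (here refl)
  no-closed-trail {g} {(a , b) ∷ es} {L} (¬w ∷ hg) L! sub p 1≤ ≤g =
    no-closed-trail hg L! sub′ p 1≤ ≤g
    where
    unused : (a , b) ∉ L
    unused i with split i p
    ... | L₁ , L₂ , refl , pieces = ¬w (closing pieces)
      where
      -- The cut edge occurs only once on the trail, so both pieces avoid it and lie in `es`.
      others : ∀ {e} → e ∈ L₂ ++ L₁ → e ∈ es
      others {e} j with ∈-++⁻ L₂ j | unique-middle L₁ L!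
      ... | inj₂ j₁ | ∉ with sub (∈-++⁺ˡ j₁)
      ...   | here refl = contradiction (∈-++⁺ˡ j₁) ∉
      ...   | there k   = k
      others {e} j | inj₁ j₂ | ∉ with sub (∈-++⁺ʳ L₁ (there j₂))
      ...   | here refl = contradiction (∈-++⁺ʳ L₁ j₂) ∉
      ...   | there k   = k
      short : length (L₂ ++ L₁) ≤ g
      short = s≤s⁻¹ (≤-trans (≤-reflexive (trans (cong suc (length-++-comm L₂ L₁))
                                                   (sym (length-++-sucʳ L₁ (a , b) L₂)))) ≤g)
      closing : _ → Walk es g (inj₁ a) (inj₂ b)
      closing (inj₁ (q , r)) = reverse (path⇒walk others short (r ++ᵖ q))
      closing (inj₂ (q , r)) = path⇒walk others short (r ++ᵖ q)
    sub′ : ∀ {e} → e ∈ L → e ∈ es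
    sub′ j with sub j
    ... | here refl = contradiction j unused
    ... | there k   = k

  -- This is a cycle opened at its closing edge, built by stripping off the first point and
  -- rectangle. The record of which points and rectangles occur on `L` keeps the induction going:
  -- each of the two new edges contains `ps zero` or `rs zero`, which are absent from the rest. For
  -- `k = 0` the closing edge is the only edge of `L`, hence the guard `1 ≤ k`.
  zigzag : ∀ {es : List (A × B)} k (ps : Fin (suc k) → A) (rs : Fin (suc k) → B) →
    Injective _≡_ _≡_ ps → Injective _≡_ _≡_ rs →
    (∀ i → (ps i , rs i) ∈ es) → (∀ (i : Fin k) → (ps (suc i) , rs (inject₁ i)) ∈ es) →
    ∃ λ L → Path L (inj₁ (ps zero)) (inj₂ (rs (fromℕ k))) × Unique L × length L ≡ suc (2 * k) ×
            (∀ {e} → e ∈ L → e ∈ es) ×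
            (∀ {e} → e ∈ L → (∃ λ i → proj₁ e ≡ ps i) × (∃ λ i → proj₂ e ≡ rs i)) ×
            (1 ≤ k → (ps zero , rs (fromℕ k)) ∉ L)
  zigzag zero ps rs p! r! h n =
    (ps zero , rs zero) ∷ [] , across [] , [] ∷ [] , refl ,
    (λ { (here refl) → h zero }) , (λ { (here refl) → (zero , refl) , (zero , refl) }) , λ ()
  zigzag (suc k) ps rs p! r! h n
    with L , p , L! , len , sub , ends , _ ←
         zigzag k (ps ∘ suc) (rs ∘ suc) (Fin.suc-injective ∘ p!) (Fin.suc-injective ∘ r!)
                (h ∘ suc) (n ∘ suc) =
    (ps zero , rs zero) ∷ (ps (suc zero) , rs zero) ∷ L , across (back p) ,
    ((λ eq → Fin.0≢1+n (p! (cong proj₁ eq))) ∷ All.tabulate (λ j eq → no₁ (subst (_∈ L) (sym eq) j))) ∷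
      All.tabulate (λ j eq → no₂ (subst (_∈ L) (sym eq) j)) ∷ L! ,
    cong (λ m → suc (suc m)) (trans len (sym (+-suc k (k + 0)))) ,
    (λ { (here refl) → h zero ; (there (here refl)) → n zero ; (there (there j)) → sub j }) ,
    (λ { (here refl) → (zero , refl) , (zero , refl)
       ; (there (here refl)) → (suc zero , refl) , (zero , refl)
       ; (there (there j)) → let ((i , x) , (i′ , y)) = ends j in (suc i , x) , (suc i′ , y) }) ,
    λ { _ (here eq) → Fin.0≢1+n (sym (r! (cong proj₂ eq)))
      ; _ (there (here eq)) → Fin.0≢1+n (p! (cong proj₁ eq))
      ; _ (there (there j)) → no₁ j }
    where
    no₁ : ∀ {r} → (ps zero , r) ∉ L
    no₁ j with ((i , x) , _) ← ends j = Fin.0≢1+n (p! x)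
    no₂ : ∀ {q} → (q , rs zero) ∉ L
    no₂ j with (_ , (i , x)) ← ends j = Fin.0≢1+n (r! x)

  no-short-cycle : ∀ {g es} k (ps : Fin (suc k) → A) (rs : Fin (suc k) → B) → HighGirth g es →
    Injective _≡_ _≡_ ps → Injective _≡_ _≡_ rs →
    (∀ i → (ps i , rs i) ∈ es) → (∀ (i : Fin k) → (ps (suc i) , rs (inject₁ i)) ∈ es) →
    (ps zero , rs (fromℕ k)) ∈ es → 1 ≤ k → g < 2 * suc k
  no-short-cycle {g} k ps rs hg p! r! h n c 1≤k
    with L , p , L! , len , sub , _ , ∉L ← zigzag k ps rs p! r! h n =
    -- Prepended and run through backwards, the closing edge completes the zigzag to a closed trail
    -- of `2 * suc k` edges.
    ≰⇒> λ ≤g → no-closed-trail hg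
      (All.tabulate (λ j eq → ∉L 1≤k (subst (_∈ L) (sym eq) j)) ∷ L!)
      (λ { (here refl) → c ; (there j) → sub j }) (back p) (s≤s z≤n)
      (≤-trans (≤-reflexive (cong suc (trans len (sym (+-suc k (k + 0)))))) (≤-trans ≤g (n≤1+n g)))

-- Contraction and disjoint union

module _ {A B A′ B′ : Set} (f : A′ × B′ → A × B) (φ : A ⊎ B → A′ ⊎ B′)
         (φ-left  : ∀ e → φ (inj₁ (proj₁ (f e))) ≡ inj₁ (proj₁ e))
         (φ-right : ∀ e → φ (inj₂ (proj₂ (f e))) ≡ inj₂ (proj₂ e)) where

  -- An edge of `ys` joins vertices with equal image and disappears, while `φ` restores the edges of
  -- `xs`, so the budget suffices. The map `f` acts on edges because different edges at one left
  -- vertex of `xs` may be attached at different places.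
  contract : ∀ {xs ys ℓ u v} → (∀ {a b} → (a , b) ∈ ys → φ (inj₁ a) ≡ φ (inj₂ b)) →
             Walk (map f xs ++ ys) ℓ u v → Walk xs ℓ (φ u) (φ v)
  contract flat done = done
  contract {xs} flat (across i w) with ∈-++⁻ (map f xs) i
  ... | inj₂ j = restart (flat j) (weaken (contract flat w))
  ... | inj₁ j with e , k , refl ← ∈-map⁻ f j =
    restart (φ-left e) (across k (restart (sym (φ-right e)) (contract flat w)))
  contract {xs} flat (back i w) with ∈-++⁻ (map f xs) i
  ... | inj₂ j = restart (sym (flat j)) (weaken (contract flat w))
  ... | inj₁ j with e , k , refl ← ∈-map⁻ f j =
    restart (φ-right e) (back k (restart (sym (φ-left e)) (contract flat w)))

  -- The lifted edges are inserted after all of `ys`: a short walk between the ends of one would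
  -- contract to a short walk between the ends of its original.
  extend : ∀ {g xs ys} → (∀ {a b} → (a , b) ∈ ys → φ (inj₁ a) ≡ φ (inj₂ b)) →
           HighGirth g xs → HighGirth g ys → HighGirth g (map f xs ++ ys)
  extend flat [] hy = hy
  extend flat (_∷_ {a} {b} ¬w hx) hy =
    (λ w → ¬w (subst₂ (Walk _ _) (φ-left (a , b)) (φ-right (a , b)) (contract flat w))) ∷ extend flat hx hy

module _ {A B A′ B′ : Set} (α : A′ → A) (β : B′ → B) (α⁻ : A → Maybe A′) (β⁻ : B → Maybe B′)
         (α⁻-α : ∀ a → α⁻ (α a) ≡ just a) (β⁻-β : ∀ b → β⁻ (β b) ≡ just b) where

  -- All vertices outside the images of α and β are collapsed to one vertex.
  disjoint-union : ∀ {g ys} xs → (∀ {a b} → (a , b) ∈ ys → α⁻ a ≡ nothing × β⁻ b ≡ nothing) →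
                   HighGirth g xs → HighGirth g ys → HighGirth g (map (Product.map α β) xs ++ ys)
  disjoint-union [] _ _ hy = hy
  -- `extend` asks only that the edges of `ys` be flat, so any vertex can receive the collapsed
  -- ones; the head of `xs` supplies one.
  disjoint-union {ys = ys} xs@((a₀ , _) ∷ _) outside hx hy =
    extend (Product.map α β) φ (λ (a , _) → cong (maybe inj₁ (inj₁ a₀)) (α⁻-α a))
                               (λ (_ , b) → cong (maybe inj₂ (inj₁ a₀)) (β⁻-β b)) flat hx hy
    where
    φ : A ⊎ B → A′ ⊎ B′
    φ (inj₁ a) = maybe inj₁ (inj₁ a₀) (α⁻ a)
    φ (inj₂ b) = maybe inj₂ (inj₁ a₀) (β⁻ b)
    flat : ∀ {a b} → (a , b) ∈ ys → φ (inj₁ a) ≡ φ (inj₂ b)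
    flat i with out₁ , out₂ ← outside i =
      trans (cong (maybe inj₁ (inj₁ a₀)) out₁) (cong (maybe inj₂ (inj₁ a₀)) (sym out₂))

-- The greedy bipartite graph

module _ {X : Set} {P Q : Pred X 0ℓ} (P? : Decidable P) (Q? : Decidable Q) where

  filter-filter : (∀ {x} → Q x → P x) → ∀ xs → filter Q? (filter P? xs) ≡ filter Q? xs
  filter-filter Q⇒P [] = refl
  filter-filter Q⇒P (x ∷ xs) with P? x
  ... | no ¬p = trans (filter-filter Q⇒P xs) (sym (filter-reject Q? (¬p ∘ Q⇒P)))
  ... | yes p with Q? x
  ...   | yes q = cong (x ∷_) (filter-filter Q⇒P xs)
  ...   | no ¬q = filter-filter Q⇒P xs

module _ {X : Set} {P : Pred X 0ℓ} (P? : Decidable P) where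

  length-filter-∁ : ∀ xs → length (filter P? xs) + length (filter (¬? ∘ P?) xs) ≡ length xs
  length-filter-∁ [] = refl
  length-filter-∁ (x ∷ xs) with P? x
  ... | yes p = cong suc (length-filter-∁ xs)
  ... | no ¬p = trans (+-suc _ _) (cong suc (length-filter-∁ xs))

module _ {X Y : Set} (_≟_ : DecidableEquality Y) (f : X → Y) where

  fibre : Y → List X → List X
  fibre y = filter (λ x → y ≟ f x)

  -- Distinct values have disjoint fibres, so deleting the fibre of `y` leaves those over `ys`
  -- intact.
  large-fibres : ∀ {Δ} (ys : List Y) xs → Unique ys → (∀ {y} → y ∈ ys → Δ ≤ length (fibre y xs)) →
                 length ys * Δ ≤ length xs
  large-fibres [] xs _ _ = z≤n
  large-fibres {Δ} (y ∷ ys) xs (y∉ys ∷ ys!) large = begin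
    Δ + length ys * Δ                 ≤⟨ +-mono-≤ (large (here refl)) (large-fibres ys rest ys! large′) ⟩
    length (fibre y xs) + length rest ≡⟨ length-filter-∁ (λ x → y ≟ f x) xs ⟩
    length xs                         ∎
    where
    open ≤-Reasoning
    rest = filter (λ x → ¬? (y ≟ f x)) xs
    large′ : ∀ {z} → z ∈ ys → Δ ≤ length (fibre z rest)
    large′ {z} z∈ys = subst (λ l → Δ ≤ length l)
      (sym (filter-filter (λ x → ¬? (y ≟ f x)) (λ x → z ≟ f x)
             (λ z≡ y≡ → All.lookup y∉ys z∈ys (trans y≡ (sym z≡))) xs))
      (large (there z∈ys))

module Ball {A B : Set} (_≟ᴬ_ : DecidableEquality A) (_≟ᴮ_ : DecidableEquality B) where

  neighbours : List (A × B) → A ⊎ B → List (A ⊎ B)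
  neighbours es (inj₁ a) = map (inj₂ ∘ proj₂) (fibre _≟ᴬ_ proj₁ a es)
  neighbours es (inj₂ b) = map (inj₁ ∘ proj₁) (fibre _≟ᴮ_ proj₂ b es)

  ball : List (A × B) → ℕ → A ⊎ B → List (A ⊎ B)
  ball es zero    u = u ∷ []
  ball es (suc ℓ) u = u ∷ concatMap (ball es ℓ) (neighbours es u)

  walk⇒∈ball : ∀ {es ℓ u v} → Walk es ℓ u v → v ∈ ball es ℓ u
  walk⇒∈ball {ℓ = zero}  done = here refl
  walk⇒∈ball {ℓ = suc ℓ} done = here refl
  walk⇒∈ball (across {a = a} i w) = there (∈-concatMap⁺ _ (Any.map (λ { refl → walk⇒∈ball w })
    (∈-map⁺ (inj₂ ∘ proj₂) (∈-filter⁺ (λ e → a ≟ᴬ proj₁ e) i refl))))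
  walk⇒∈ball (back {b = b} i w) = there (∈-concatMap⁺ _ (Any.map (λ { refl → walk⇒∈ball w })
    (∈-map⁺ (inj₁ ∘ proj₁) (∈-filter⁺ (λ e → b ≟ᴮ proj₂ e) i refl))))

  module _ {es Δ} (degree≤ : ∀ u → length (neighbours es u) ≤ Δ) where

    length-ball : ∀ ℓ u → length (ball es ℓ u) ≤ suc Δ ^ ℓ
    length-ball zero    u = ≤-refl
    length-ball (suc ℓ) u =
      -- One of the `suc Δ` summands pays for the centre, the other `Δ` for the balls around the
      -- neighbours.
      +-mono-≤ (m^n>0 (suc Δ) ℓ) (≤-trans (go (neighbours es u)) (*-monoˡ-≤ (suc Δ ^ ℓ) (degree≤ u)))
      where
      go : ∀ us → length (concatMap (ball es ℓ) us) ≤ length us * suc Δ ^ ℓ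
      go [] = z≤n
      go (u ∷ us) = ≤-trans (≤-reflexive (length-++ (ball es ℓ u))) (+-mono-≤ (length-ball ℓ u) (go us))

-- A slot (v , j) is joined to some vertex (j , e) of the block of j, so that the order of the blocks
-- agrees with that of the points of a copy.  Right degrees are capped at 2P: then at most half of a
-- block is saturated, and the rest of it does not fit into a ball of radius g.
module Greedy {J : Set} (_≟ᴶ_ : DecidableEquality J) {js : List J} (∈-js : ∀ j → j ∈ js)
              {P M g : ℕ} .{{_ : NonZero P}} (|js|≤P : length js ≤ P)
              (small : 2 * suc (2 * P) ^ g < M) where

  -- Left vertices will become copies, right ones columns; a slot is a point of a copy waiting for
  -- its column.
  Left Right Slot : Set
  Left  = Fin (P * M)
  Right = J × Fin M
  Slot  = Left × J

  _≟ᴿ_ : DecidableEquality Right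
  _≟ᴿ_ = ≡-dec _≟ᴶ_ Fin._≟_

  open Ball {Left} {Right} Fin._≟_ _≟ᴿ_

  module _ {es : List (Left × Right)} (degree≤ : ∀ u → length (neighbours es u) ≤ 2 * P)
           (j : J) (block≤ : length (filter (λ e → j ≟ᴶ proj₁ (proj₂ e)) es) ≤ P * M) (v : Left) where

    Full Bad : Fin M → Set
    Full e = 2 * P ≤ length (fibre _≟ᴿ_ proj₂ (j , e) es)
    Bad e = Full e ⊎ inj₂ (j , e) ∈ ball es g (inj₁ v)

    Full? : Decidable Full
    Full? e = _ ≤? _

    Bad? : Decidable Bad
    Bad? e = Full? e ⊎-dec DecMembership._∈?_ (Sum.≡-dec Fin._≟_ _≟ᴿ_) _ _

    full = filter Full? (allFin M)

    -- Each full vertex takes `2 * P` of the at most `P * M` edges that end in the block.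
    few-full : 2 * length full ≤ M
    few-full = *-cancelʳ-≤ (2 * length full) M P (begin
      2 * length full * P           ≡⟨ cong (_* P) (*-comm 2 (length full)) ⟩
      length full * 2 * P           ≡⟨ *-assoc (length full) 2 P ⟩
      length full * (2 * P)         ≡⟨ cong (_* (2 * P)) (length-map (j ,_) full) ⟨
      length (map (j ,_) full) * (2 * P)
        ≤⟨ large-fibres _≟ᴿ_ proj₂ (map (j ,_) full) (filter in-block? es) full! large ⟩
      length (filter in-block? es)  ≤⟨ block≤ ⟩
      P * M                         ≡⟨ *-comm P M ⟩
      M * P                         ∎)
      where
      open ≤-Reasoning
      in-block? = λ (e : Left × Right) → j ≟ᴶ proj₁ (proj₂ e)
      full! : Unique (map (j ,_) full)
      full! = Unique.map⁺ ,-injectiveʳ (Unique.filter⁺ Full? (Unique.allFin⁺ M))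
      large : ∀ {r} → r ∈ map (j ,_) full → 2 * P ≤ length (fibre _≟ᴿ_ proj₂ r (filter in-block? es))
      large r∈ with e , e∈ , refl ← ∈-map⁻ (j ,_) r∈ =
        subst (λ l → 2 * P ≤ length l)
          (sym (filter-filter in-block? (λ x → (j , e) ≟ᴿ proj₂ x) (cong proj₁) es))
          (proj₂ (∈-filter⁻ Full? {xs = allFin M} e∈))

    -- Otherwise the full vertices and the ball would cover the block. Counting twice gives
    -- `2 * M ≤ M + 2 * suc (2 * P) ^ g`, against `small`.
    not-all-bad : ¬ (∀ e → Bad e)
    not-all-bad bad = <-irrefl refl (begin-strict
      2 * M                                             ≤⟨ *-monoʳ-≤ 2 M≤ ⟩
      2 * (length full + length (ball es g (inj₁ v)))   ≡⟨ *-distribˡ-+ 2 (length full) _ ⟩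
      2 * length full + 2 * length (ball es g (inj₁ v))
        ≤⟨ +-mono-≤ few-full (*-monoʳ-≤ 2 (length-ball degree≤ g (inj₁ v))) ⟩
      M + 2 * suc (2 * P) ^ g                           <⟨ +-monoʳ-< M small ⟩
      M + M                                             ≡⟨ cong (M +_) (+-identityʳ M) ⟨
      2 * M                                             ∎)
      where
      open ≤-Reasoning
      inj : Fin M → Left ⊎ Right
      inj e = inj₂ (j , e)
      cover : ∀ {x} → x ∈ map inj (allFin M) → x ∈ map inj full ++ ball es g (inj₁ v)
      cover x∈ with e , _ , refl ← ∈-map⁻ inj x∈ | bad e
      ... | inj₁ f = ∈-++⁺ˡ (∈-map⁺ inj (∈-filter⁺ Full? (∈-allFin e) f))
      ... | inj₂ b = ∈-++⁺ʳ (map inj full) b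
      M≤ : M ≤ length full + length (ball es g (inj₁ v))
      M≤ = begin
        M                                                   ≡⟨ length-tabulate {n = M} (λ i → i) ⟨
        length (allFin M)                                   ≡⟨ length-map inj (allFin M) ⟨
        length (map inj (allFin M))
          ≤⟨ unique-⊆⇒length≤ (Unique.map⁺ (,-injectiveʳ ∘ Sum.inj₂-injective) (Unique.allFin⁺ M)) cover ⟩
        length (map inj full ++ ball es g (inj₁ v))         ≡⟨ length-++ (map inj full) ⟩
        length (map inj full) + length (ball es g (inj₁ v)) ≡⟨ cong (_+ _) (length-map inj full) ⟩
        length full + length (ball es g (inj₁ v))           ∎

    pick : ∃ λ e → length (fibre _≟ᴿ_ proj₂ (j , e) es) < 2 * P × ¬ Walk es g (inj₁ v) (inj₂ (j , e))
    pick with Fin.¬∀⟶∃¬ M Bad Bad? not-all-bad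
    ... | e , good = e , ≰⇒> (good ∘ inj₁) , good ∘ inj₂ ∘ walk⇒∈ball

  module _ (h : Slot → Fin M) where

    edge : Slot → Left × Right
    edge (v , j) = v , j , h (v , j)

    edge-injective : ∀ {s t} → edge s ≡ edge t → s ≡ t
    edge-injective eq = cong₂ _,_ (cong proj₁ eq) (cong (proj₁ ∘ proj₂) eq)

    -- As `h` is a function, `v` sends at most one edge into each block, so the greedy choice has to
    -- watch the right degrees only.
    left-degree≤ : ∀ {slots} → Unique slots → ∀ v → length (fibre Fin._≟_ proj₁ v (map edge slots)) ≤ P
    left-degree≤ {slots} slots! v = ≤-trans
      (unique-⊆⇒length≤ (Unique.filter⁺ (λ e → v Fin.≟ proj₁ e) (Unique.map⁺ edge-injective slots!)) sub)
      (≤-trans (≤-reflexive (length-map (λ j → edge (v , j)) js)) |js|≤P)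
      where
      sub : ∀ {e} → e ∈ fibre Fin._≟_ proj₁ v (map edge slots) → e ∈ map (λ j → edge (v , j)) js
      sub e∈ with e∈′ , refl ← ∈-filter⁻ (λ e → v Fin.≟ proj₁ e) {xs = map edge slots} e∈
        with (_ , j) , _ , refl ← ∈-map⁻ edge e∈′ = ∈-map⁺ _ (∈-js j)

    block-size≤ : ∀ {slots} → Unique slots → ∀ j →
                  length (filter (λ e → j ≟ᴶ proj₁ (proj₂ e)) (map edge slots)) ≤ P * M
    block-size≤ {slots} slots! j = ≤-trans
      (unique-⊆⇒length≤ (Unique.filter⁺ (λ e → j ≟ᴶ proj₁ (proj₂ e)) (Unique.map⁺ edge-injective slots!)) sub)
      (≤-reflexive (trans (length-map (λ v → edge (v , j)) (allFin (P * M)))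
                          (length-tabulate {n = P * M} (λ i → i))))
      where
      sub : ∀ {e} → e ∈ filter (λ e → j ≟ᴶ proj₁ (proj₂ e)) (map edge slots) →
            e ∈ map (λ v → edge (v , j)) (allFin (P * M))
      sub e∈ with e∈′ , refl ← ∈-filter⁻ (λ e → j ≟ᴶ proj₁ (proj₂ e)) {xs = map edge slots} e∈
        with (v , _) , _ , refl ← ∈-map⁻ edge e∈′ = ∈-map⁺ _ (∈-allFin v)

  greedy : ∀ slots → Unique slots → Σ (Slot → Fin M) λ h → HighGirth g (map (edge h) slots) ×
           (∀ r → length (fibre _≟ᴿ_ proj₂ r (map (edge h) slots)) ≤ 2 * P)
  -- A placeholder, overwritten slot by slot; `small` shows that `Fin M` is inhabited.
  greedy [] _ = (λ _ → fromℕ< small) , [] , λ _ → z≤n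
  greedy (s@(v , j) ∷ slots) (s∉ ∷ slots!) with greedy slots slots!
  ... | h , hg , right≤ with pick degree≤ j (block-size≤ h slots! j) v
    where
    degree≤ : ∀ u → length (neighbours (map (edge h) slots) u) ≤ 2 * P
    degree≤ (inj₁ a) = ≤-trans (≤-reflexive (length-map _ (fibre Fin._≟_ proj₁ a (map (edge h) slots))))
                               (≤-trans (left-degree≤ h slots! a) (m≤m+n P (P + 0)))
    degree≤ (inj₂ r) = ≤-trans (≤-reflexive (length-map _ (fibre _≟ᴿ_ proj₂ r (map (edge h) slots))))
                               (right≤ r)
  ...   | e , deg< , ¬w =
    h′ , subst (λ es → HighGirth g es) (sym edges′) (¬w ∷ hg) ,
    λ r → subst (λ es → length (fibre _≟ᴿ_ proj₂ r es) ≤ 2 * P) (sym edges′) (right≤′ r)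
    where
    _≟ˢ_ : DecidableEquality Slot
    _≟ˢ_ = ≡-dec Fin._≟_ _≟ᴶ_
    -- The slots are distinct, so changing `h` at `s` alone leaves the edges chosen before as they
    -- are.
    h′ : Slot → Fin M
    h′ t with t ≟ˢ s
    ... | yes _ = e
    ... | no _  = h t
    h′-new : h′ s ≡ e
    h′-new with s ≟ˢ s
    ... | yes _ = refl
    ... | no ≢  = contradiction refl ≢
    h′-old : ∀ {t} → s ≢ t → h′ t ≡ h t
    h′-old {t} s≢t with t ≟ˢ s
    ... | yes eq = contradiction (sym eq) s≢t
    ... | no _   = refl
    edges′ : map (edge h′) (s ∷ slots) ≡ (v , j , e) ∷ map (edge h) slots
    edges′ = cong₂ _∷_ (cong (λ x → v , j , x) h′-new)
                       (map-cong-local (All.map (λ s≢t → cong (λ x → _ , _ , x) (h′-old s≢t)) s∉))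
    right≤′ : ∀ r → length (fibre _≟ᴿ_ proj₂ r ((v , j , e) ∷ map (edge h) slots)) ≤ 2 * P
    right≤′ r with r ≟ᴿ (j , e)
    ... | yes refl = deg<
    ... | no _     = right≤ r

-- Arrangements of points and rectangles

-- Coordinates are natural numbers and rectangles are half-open, [left, right) × [bottom, top).
-- No two points share an abscissa, and a rectangle is determined by its lower left corner.
record Arrangement (g P R E : ℕ) : Set₁ where
  field
    Pt Rc : Set
    pts : Fin P ↔ Pt
    rcs : Fin R ↔ Rc
    X Y : Pt → ℕ
    left right bottom top : Rc → ℕ
    height : ℕ
    Y<height : ∀ p → Y p < height
    top≤height : ∀ r → top r ≤ height
    left<right : ∀ r → left r < right r
    bottom<top : ∀ r → bottom r < top r
    X-injective : ∀ {p q} → X p ≡ X q → p ≡ q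
    corner-injective : ∀ {r s} → left r ≡ left s → bottom r ≡ bottom s → r ≡ s

  Inside : Pt → Rc → Set
  Inside p r = (left r ≤ X p × X p < right r) × (bottom r ≤ Y p × Y p < top r)

  field
    incidences : List (Pt × Rc)
    sound    : ∀ {p r} → (p , r) ∈ incidences → Inside p r
    complete : ∀ {p r} → Inside p r → (p , r) ∈ incidences
    size : length incidences ≡ E
    girth : HighGirth g incidences

-- This starts the iteration and also serves every `n` below `width 1`.
base : ∀ g n → Arrangement g n 1 n
base g n = record
  { Pt = Fin n ; Rc = Fin 1 ; pts = ↔-id _ ; rcs = ↔-id _
  ; X = toℕ ; Y = λ _ → 0 ; left = λ _ → 0 ; right = λ _ → suc n ; bottom = λ _ → 0 ; top = λ _ → 1
  ; height = 1 ; Y<height = λ _ → ≤-refl ; top≤height = λ _ → ≤-refl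
  ; left<right = λ _ → z<s ; bottom<top = λ _ → z<s
  ; X-injective = Fin.toℕ-injective
  ; corner-injective = λ { {zero} {zero} _ _ → refl }
  ; incidences = map (_, zero) (allFin n)
  ; sound = λ {p} _ → (z≤n , m≤n⇒m≤1+n (Fin.toℕ<n p)) , z≤n , z<s
  ; complete = λ { {p} {zero} _ → ∈-map⁺ (_, zero) (∈-allFin p) }
  ; size = trans (length-map _ (allFin n)) (length-tabulate {n = n} (λ i → i))
  ; girth = star (Unique.allFin⁺ n)
  }
  where
  -- Each inserted edge brings in a point that has no edge yet, from which no walk can leave.
  star : ∀ {ps : List (Fin n)} → Unique ps → HighGirth g (map (_, zero {0}) ps)
  star [] = []
  star {p ∷ ps} (p∉ps ∷ ps!) = isolated ∷ star ps!
    where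
    isolated : ∀ {ℓ r} → ¬ Walk (map (_, zero {0}) ps) ℓ (inj₁ p) (inj₂ r)
    isolated (across i _) with _ , p∈ps , refl ← ∈-map⁻ (_, zero) i = All.lookup p∉ps p∈ps refl

-- Stacking copies and adding columns

module _ {S : ℕ} where

  -- Here and below `x * S + o` with `o < S` is read as two digits in base `S`; a comparison with a
  -- multiple of `S` sees the leading digit only.
  digit-≤ : ∀ a x o → a ≤ x → a * S ≤ x * S + o
  digit-≤ a x o a≤x = ≤-trans (*-monoˡ-≤ S a≤x) (m≤m+n _ o)

  digit-< : ∀ x c {o} → o < S → x < c → x * S + o < c * S
  digit-< x c {o} o<S x<c = begin-strict
    x * S + o <⟨ +-monoʳ-< (x * S) o<S ⟩
    x * S + S ≡⟨ +-comm (x * S) S ⟩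
    suc x * S ≤⟨ *-monoˡ-≤ S x<c ⟩
    c * S     ∎
    where open ≤-Reasoning

  digit-≤⁻ : ∀ a x {o} → o < S → a * S ≤ x * S + o → a ≤ x
  digit-≤⁻ a x o<S h = ≮⇒≥ λ x<a → <⇒≱ (digit-< x a o<S x<a) h

  digit-<⁻ : ∀ x c o → x * S + o < c * S → x < c
  digit-<⁻ x c o h = ≰⇒> λ c≤x → <⇒≱ h (digit-≤ c x o c≤x)

  digit-quotient : ∀ x y {o o′} → o < S → o′ < S → x * S + o ≡ y * S + o′ → x ≡ y
  digit-quotient x y {o} {o′} o< o′< eq = ≤-antisym
    (digit-≤⁻ x y o′< (≤-trans (m≤m+n _ o) (≤-reflexive eq)))
    (digit-≤⁻ y x o< (≤-trans (m≤m+n _ o′) (≤-reflexive (sym eq))))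

  digit-unique : ∀ x y {o o′} → o < S → o′ < S → x * S + o ≡ y * S + o′ → x ≡ y × o ≡ o′
  digit-unique x y o< o′< eq with digit-quotient x y o< o′< eq
  ... | refl = refl , +-cancelˡ-≡ (x * S) _ _ eq

module Step {g P R E M : ℕ} .{{_ : NonZero P}} (𝒜 : Arrangement g P R E)
            (small : 2 * suc (2 * P) ^ g < M) where

  open Arrangement 𝒜
  open Inverse pts using (to; from; strictlyInverseˡ)

  N = P * M

  _≟ᴾ_ : DecidableEquality Pt
  p ≟ᴾ q = map′ X-injective (cong X) (X p ≟ X q)

  points : List Pt
  points = map to (allFin P)

  ∈-points : ∀ p → p ∈ points
  ∈-points p = subst (_∈ points) (strictlyInverseˡ p) (∈-map⁺ to (∈-allFin (from p)))

  length-points : length points ≡ P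
  length-points = trans (length-map to (allFin P)) (length-tabulate {n = P} (λ i → i))

  points-unique : Unique points
  points-unique = Unique.map⁺ (Injection.injective (↔⇒↣ pts)) (Unique.allFin⁺ P)

  open Greedy _≟ᴾ_ ∈-points {P} {M} {g} (≤-reflexive length-points) small using (Slot; edge; greedy)

  slots : List Slot
  slots = cartesianProduct (allFin N) points

  greedy-choice = greedy slots (Unique.cartesianProduct⁺ (Unique.allFin⁺ N) points-unique)

  h : Slot → Fin M
  h = proj₁ greedy-choice

  Rc′ : Set
  Rc′ = (Fin N × Rc) ⊎ (Pt × Fin M)

  -- An abscissa has three digits: that of `p` in `𝒜` keeps the order within a copy, the middle one
  -- names a column in the block of `p`, and the last one separates the copies. In the ordinates,
  -- `suc` lifts every strip off the bottom line of the columns, so that no copied rectangle shares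
  -- its corner with a column.
  X′ Y′ : Slot → ℕ
  X′ (v , p) = (X p * M + toℕ (h (v , p))) * N + toℕ v
  Y′ (v , p) = suc (toℕ v * height + Y p)

  left′ right′ bottom′ top′ : Rc′ → ℕ
  left′ (inj₁ (v , r)) = left r * M * N
  left′ (inj₂ (p , e)) = (X p * M + toℕ e) * N
  right′ (inj₁ (v , r)) = right r * M * N
  right′ (inj₂ (p , e)) = suc (X p * M + toℕ e) * N
  bottom′ (inj₁ (v , r)) = suc (toℕ v * height + bottom r)
  bottom′ (inj₂ (p , e)) = 0
  top′ (inj₁ (v , r)) = suc (toℕ v * height + top r)
  top′ (inj₂ (p , e)) = suc (N * height)

  Inside′ : Slot → Rc′ → Set
  Inside′ p r = (left′ r ≤ X′ p × X′ p < right′ r) × (bottom′ r ≤ Y′ p × Y′ p < top′ r)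

  vN : (v : Fin N) → toℕ v < N
  vN = Fin.toℕ<n

  instance
    M≢0 : NonZero M
    M≢0 = >-nonZero (≤-trans (s≤s z≤n) small)
    N≢0 : NonZero N
    N≢0 = m*n≢0 P M

  inside-copy : ∀ {v p r} → Inside p r → Inside′ (v , p) (inj₁ (v , r))
  inside-copy {v} {p} {r} ((l , r′) , (b , t)) =
    (digit-≤ (left r * M) (X p * M + o) (toℕ v) (digit-≤ (left r) (X p) o l) ,
     digit-< (X p * M + o) (right r * M) (vN v) (digit-< (X p) (right r) (Fin.toℕ<n (h (v , p))) r′)) ,
    s≤s (+-monoʳ-≤ (toℕ v * height) b) , s≤s (+-monoʳ-< (toℕ v * height) t)
    where
    o = toℕ (h (v , p))

  -- The strips have height `height`, so the leading digit of the ordinate forces `v ≡ w`; then the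
  -- two lower digits of the abscissa are dropped.
  inside-copy⁻ : ∀ {v w p r} → Inside′ (v , p) (inj₁ (w , r)) → v ≡ w × Inside p r
  inside-copy⁻ {v} {w} {p} {r} ((l , r′) , (b , t)) with Fin.toℕ-injective (≤-antisym v≤w w≤v)
    where
    w≤v : toℕ w ≤ toℕ v
    w≤v = digit-≤⁻ (toℕ w) (toℕ v) (Y<height p) (≤-trans (m≤m+n _ (bottom r)) (s≤s⁻¹ b))
    v≤w : toℕ v ≤ toℕ w
    v≤w = s≤s⁻¹ (digit-<⁻ (toℕ v) (suc (toℕ w)) (Y p) (begin-strict
      toℕ v * height + Y p   <⟨ s≤s⁻¹ t ⟩
      toℕ w * height + top r ≤⟨ +-monoʳ-≤ (toℕ w * height) (top≤height r) ⟩
      toℕ w * height + height ≡⟨ +-comm (toℕ w * height) height ⟩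
      suc (toℕ w) * height   ∎))
      where open ≤-Reasoning
  ... | refl = refl ,
    (digit-≤⁻ (left r) (X p) h< (digit-≤⁻ (left r * M) (X p * M + o) (vN v) l) ,
     digit-<⁻ (X p) (right r) o (digit-<⁻ (X p * M + o) (right r * M) (toℕ v) r′)) ,
    +-cancelˡ-≤ (toℕ v * height) _ _ (s≤s⁻¹ b) , +-cancelˡ-< (toℕ v * height) _ _ (s≤s⁻¹ t)
    where
    o = toℕ (h (v , p))
    h< : o < M
    h< = Fin.toℕ<n (h (v , p))

  inside-column : ∀ v p → Inside′ (v , p) (inj₂ (p , h (v , p)))
  inside-column v p =
    (digit-≤ {N} (X p * M + toℕ (h (v , p))) _ (toℕ v) ≤-refl ,
     digit-< (X p * M + toℕ (h (v , p))) _ (vN v) ≤-refl) ,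
    z≤n , s≤s (digit-< (toℕ v) N (Y<height p) (vN v))

  -- A column leaves only the last digit of the abscissa free, so the first two determine `q` and
  -- `e`.
  inside-column⁻ : ∀ {v p q e} → Inside′ (v , p) (inj₂ (q , e)) → q ≡ p × e ≡ h (v , p)
  inside-column⁻ {v} {p} {q} {e} ((l , r) , _)
    with eq , eq′ ← digit-unique (X q) (X p) (Fin.toℕ<n e) (Fin.toℕ<n (h (v , p)))
           (≤-antisym (digit-≤⁻ _ _ (vN v) l) (s≤s⁻¹ (digit-<⁻ _ _ (toℕ v) r))) =
    X-injective eq , Fin.toℕ-injective eq′

  copy : Fin N → Pt × Rc → Slot × Rc′
  copy v = Product.map (v ,_) (λ r → inj₁ (v , r))

  -- The block of the right end tells at which point of copy `v` the edge is attached.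
  column : Fin N × (Pt × Fin M) → Slot × Rc′
  column (v , (p , e)) = (v , p) , inj₂ (p , e)

  copies : List (Fin N) → List (Slot × Rc′)
  copies = concatMap (λ v → map (copy v) incidences)

  hyperedges = map (edge h) slots

  -- The copies stand at the tail, so they are inserted first and the column edges are added by
  -- `extend`.
  incidences′ : List (Slot × Rc′)
  incidences′ = map column hyperedges ++ copies (allFin N)

  ∈-copies⁻ : ∀ {x} vs → x ∈ copies vs → ∃₂ λ v e → v ∈ vs × e ∈ incidences × x ≡ copy v e
  ∈-copies⁻ (v ∷ vs) x∈ with ∈-++⁻ (map (copy v) incidences) x∈
  ... | inj₁ i with e , e∈ , eq ← ∈-map⁻ (copy v) i = v , e , here refl , e∈ , eq
  ... | inj₂ i with w , e , w∈ , e∈ , eq ← ∈-copies⁻ vs i = w , e , there w∈ , e∈ , eq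

  ∈-copies⁺ : ∀ {v e vs} → v ∈ vs → e ∈ incidences → copy v e ∈ copies vs
  ∈-copies⁺ {v} (here refl) e∈ = ∈-++⁺ˡ (∈-map⁺ (copy v) e∈)
  ∈-copies⁺ {vs = w ∷ _} (there v∈) e∈ = ∈-++⁺ʳ (map (copy w) incidences) (∈-copies⁺ v∈ e∈)

  sound′ : ∀ {p r} → (p , r) ∈ incidences′ → Inside′ p r
  sound′ i with ∈-++⁻ (map column hyperedges) i
  ... | inj₂ j with v , e , _ , e∈ , refl ← ∈-copies⁻ (allFin N) j = inside-copy (sound e∈)
  ... | inj₁ j with _ , k , refl ← ∈-map⁻ column j with (v , p) , _ , refl ← ∈-map⁻ (edge h) k =
    inside-column v p

  complete′ : ∀ {p r} → Inside′ p r → (p , r) ∈ incidences′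
  complete′ {v , p} {inj₁ (w , r)} i with inside-copy⁻ {v} {w} {p} {r} i
  ... | refl , i′ = ∈-++⁺ʳ (map column hyperedges) (∈-copies⁺ (∈-allFin v) (complete i′))
  complete′ {v , p} {inj₂ (q , e)} i with inside-column⁻ {v} {p} {q} {e} i
  ... | refl , refl = ∈-++⁺ˡ (∈-map⁺ column (∈-map⁺ (edge h) (∈-cartesianProduct⁺ (∈-allFin v) (∈-points p))))

  length-copies : ∀ vs → length (copies vs) ≡ length vs * E
  length-copies [] = refl
  length-copies (v ∷ vs) = trans (length-++ (map (copy v) incidences))
    (cong₂ _+_ (trans (length-map (copy v) incidences) size) (length-copies vs))

  length-slots : ∀ (vs : List (Fin N)) → length (cartesianProduct vs points) ≡ length vs * P
  length-slots [] = refl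
  length-slots (v ∷ vs) = trans (length-++ (map (v ,_) points))
    (cong₂ _+_ (trans (length-map (v ,_) points) length-points) (length-slots vs))

  size′ : length incidences′ ≡ N * P + N * E
  size′ = trans (length-++ (map column hyperedges)) (cong₂ _+_
    (trans (length-map column hyperedges) (trans (length-map (edge h) slots)
      (trans (length-slots (allFin N)) (cong (_* P) |allFin|))))
    (trans (length-copies (allFin N)) (cong (_* E) |allFin|)))
    where
    |allFin| : length (allFin N) ≡ N
    |allFin| = length-tabulate {n = N} (λ i → i)

  copies-girth : ∀ {vs} → Unique vs → HighGirth g (copies vs)
  copies-girth [] = []
  copies-girth {v ∷ vs} (v∉vs ∷ vs!) =
    disjoint-union (v ,_) (λ r → inj₁ (v , r)) point⁻ rect⁻ point⁻-inverse rect⁻-inverse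
                   incidences outside girth (copies-girth vs!)
    where
    point⁻ : Slot → Maybe Pt
    point⁻ (w , p) with w Fin.≟ v
    ... | yes _ = just p
    ... | no _  = nothing
    rect⁻ : Rc′ → Maybe Rc
    rect⁻ (inj₂ _) = nothing
    rect⁻ (inj₁ (w , r)) with w Fin.≟ v
    ... | yes _ = just r
    ... | no _  = nothing
    point⁻-inverse : ∀ p → point⁻ (v , p) ≡ just p
    point⁻-inverse p with v Fin.≟ v
    ... | yes _ = refl
    ... | no ≢  = contradiction refl ≢
    rect⁻-inverse : ∀ r → rect⁻ (inj₁ (v , r)) ≡ just r
    rect⁻-inverse r with v Fin.≟ v
    ... | yes _ = refl
    ... | no ≢  = contradiction refl ≢
    outside : ∀ {p r} → (p , r) ∈ copies vs → point⁻ p ≡ nothing × rect⁻ r ≡ nothing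
    outside i with w , _ , w∈ , _ , refl ← ∈-copies⁻ vs i with w Fin.≟ v
    ... | yes refl = contradiction refl (All.lookup v∉vs w∈)
    ... | no _     = refl , refl

  -- `φ` shrinks each copy, points and rectangles alike, to its index and keeps the columns; what
  -- remains is the greedy graph.
  girth′ : HighGirth g incidences′
  girth′ = extend column φ (λ _ → refl) (λ _ → refl) flat (proj₁ (proj₂ greedy-choice))
                  (copies-girth (Unique.allFin⁺ N))
    where
    φ : Slot ⊎ Rc′ → Fin N ⊎ (Pt × Fin M)
    φ (inj₁ (v , _))        = inj₁ v
    φ (inj₂ (inj₁ (v , _))) = inj₁ v
    φ (inj₂ (inj₂ r))       = inj₂ r
    flat : ∀ {p r} → (p , r) ∈ copies (allFin N) → φ (inj₁ p) ≡ φ (inj₂ r)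
    flat i with _ , _ , _ , _ , refl ← ∈-copies⁻ (allFin N) i = refl

  X′-injective : ∀ {p q} → X′ p ≡ X′ q → p ≡ q
  X′-injective {v , p} {w , q} eq
    with eq₁ , eq₂ ← digit-unique _ _ (vN v) (vN w) eq
    with eq₃ , _ ← digit-unique (X p) (X q) (Fin.toℕ<n (h (v , p))) (Fin.toℕ<n (h (w , q))) eq₁ =
    cong₂ _,_ (Fin.toℕ-injective eq₂) (X-injective eq₃)

  corner′-injective : ∀ {r s} → left′ r ≡ left′ s → bottom′ r ≡ bottom′ s → r ≡ s
  corner′-injective {inj₁ (v , r)} {inj₁ (w , s)} l b
    with eq₁ , eq₂ ← digit-unique (toℕ v) (toℕ w) (<-≤-trans (bottom<top r) (top≤height r))
                       (<-≤-trans (bottom<top s) (top≤height s)) (suc-injective b) =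
    cong₂ (λ x y → inj₁ (x , y)) (Fin.toℕ-injective eq₁)
      (corner-injective (*-cancelʳ-≡ _ _ M (*-cancelʳ-≡ _ _ N l)) eq₂)
  corner′-injective {inj₂ (p , e)} {inj₂ (q , f)} l b
    with eq₁ , eq₂ ← digit-unique (X p) (X q) (Fin.toℕ<n e) (Fin.toℕ<n f) (*-cancelʳ-≡ _ _ N l) =
    cong₂ (λ x y → inj₂ (x , y)) (X-injective eq₁) (Fin.toℕ-injective eq₂)

  step : Arrangement g (N * P) (N * R + N) (N * P + N * E)
  step = record
    { Pt = Slot ; Rc = Rc′
    ; pts = (↔-id _ ×-↔ pts) ↔-∘ Fin.*↔×
    ; rcs = ((((↔-id _ ×-↔ rcs) ↔-∘ Fin.*↔×) ⊎-↔ ((pts ×-↔ ↔-id _) ↔-∘ Fin.*↔×)) ↔-∘ Fin.+↔⊎)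
    ; X = X′ ; Y = Y′ ; left = left′ ; right = right′ ; bottom = bottom′ ; top = top′
    ; height = suc (N * height)
    ; Y<height = λ { (v , p) → s≤s (digit-< (toℕ v) N (Y<height p) (vN v)) }
    ; top≤height = λ { (inj₁ (v , r)) → s≤s (≤-trans (+-monoʳ-≤ (toℕ v * height) (top≤height r))
                         (≤-trans (≤-reflexive (+-comm (toℕ v * height) height)) (*-monoˡ-≤ height (vN v))))
                     ; (inj₂ _) → ≤-refl }
    ; left<right = λ { (inj₁ (v , r)) → *-monoˡ-< N (*-monoˡ-< M (left<right r))
                     ; (inj₂ (p , e)) → *-monoˡ-< N (n<1+n (X p * M + toℕ e)) }
    ; bottom<top = λ { (inj₁ (v , r)) → s≤s (+-monoʳ-< (toℕ v * height) (bottom<top r)) ; (inj₂ _) → z<s }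
    ; X-injective = X′-injective
    ; corner-injective = corner′-injective
    ; incidences = incidences′
    ; sound = sound′
    ; complete = complete′
    ; size = size′
    ; girth = girth′
    }

-- The new points lie to the left of the shifted `𝒜`, at ordinate `height` and thus above all old
-- rectangles. The new rectangles are unit cells one level higher, where there are no points.
pad : ∀ {g P R E} i j → Arrangement g P R E → Arrangement g (P + i) (R + j) E
pad {g} {P} {R} {E} i j 𝒜 = record
  { Pt = Pt′ ; Rc = Rc′
  ; pts = (pts ⊎-↔ ↔-id _) ↔-∘ Fin.+↔⊎
  ; rcs = (rcs ⊎-↔ ↔-id _) ↔-∘ Fin.+↔⊎
  ; X = X′ ; Y = Y′ ; left = left′ ; right = right′ ; bottom = bottom′ ; top = top′
  ; height = 2 + height
  ; Y<height = λ { (inj₁ p) → <-trans (Y<height p) (m<n⇒m<1+n ≤-refl) ; (inj₂ _) → m<n⇒m<1+n ≤-refl }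
  ; top≤height = λ { (inj₁ r) → ≤-trans (top≤height r) (m≤n+m height 2) ; (inj₂ _) → ≤-refl }
  ; left<right = λ { (inj₁ r) → +-monoʳ-< i (left<right r) ; (inj₂ _) → ≤-refl }
  ; bottom<top = λ { (inj₁ r) → bottom<top r ; (inj₂ _) → ≤-refl }
  ; X-injective = X′-injective
  ; corner-injective = corner′-injective
  ; incidences = map f incidences
  ; sound = λ i∈ → sound′ (∈-map⁻ f i∈)
  ; complete = complete′
  ; size = trans (length-map f incidences) size
  ; girth = subst (HighGirth g) (++-identityʳ _)
      (disjoint-union inj₁ inj₁ isInj₁ isInj₁ (λ _ → refl) (λ _ → refl) incidences (λ ()) girth [])
  }
  where
  open Arrangement 𝒜
  Pt′ Rc′ : Set
  Pt′ = Pt ⊎ Fin i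
  Rc′ = Rc ⊎ Fin j
  X′ Y′ : Pt′ → ℕ
  X′ (inj₁ p) = i + X p
  X′ (inj₂ k) = toℕ k
  Y′ (inj₁ p) = Y p
  Y′ (inj₂ k) = height
  left′ right′ bottom′ top′ : Rc′ → ℕ
  left′ (inj₁ r) = i + left r
  left′ (inj₂ k) = toℕ k
  right′ (inj₁ r) = i + right r
  right′ (inj₂ k) = suc (toℕ k)
  bottom′ (inj₁ r) = bottom r
  bottom′ (inj₂ k) = suc height
  top′ (inj₁ r) = top r
  top′ (inj₂ k) = suc (suc height)
  f : Pt × Rc → Pt′ × Rc′
  f = Product.map inj₁ inj₁
  X′-injective : ∀ {p q} → X′ p ≡ X′ q → p ≡ q
  X′-injective {inj₁ p} {inj₁ q} eq = cong inj₁ (X-injective (+-cancelˡ-≡ i _ _ eq))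
  X′-injective {inj₁ p} {inj₂ k} eq =
    contradiction (≤-trans (m≤m+n i (X p)) (≤-reflexive eq)) (<⇒≱ (Fin.toℕ<n k))
  X′-injective {inj₂ k} {inj₁ p} eq =
    contradiction (≤-trans (m≤m+n i (X p)) (≤-reflexive (sym eq))) (<⇒≱ (Fin.toℕ<n k))
  X′-injective {inj₂ k} {inj₂ l} eq = cong inj₂ (Fin.toℕ-injective eq)
  high : ∀ r → bottom r ≢ suc height
  high r eq = <⇒≱ (<-≤-trans (bottom<top r) (top≤height r)) (≤-trans (n≤1+n height) (≤-reflexive (sym eq)))
  corner′-injective : ∀ {r s} → left′ r ≡ left′ s → bottom′ r ≡ bottom′ s → r ≡ s
  corner′-injective {inj₁ r} {inj₁ s} l b = cong inj₁ (corner-injective (+-cancelˡ-≡ i _ _ l) b)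
  corner′-injective {inj₁ r} {inj₂ k} l b = contradiction b (high r)
  corner′-injective {inj₂ k} {inj₁ r} l b = contradiction (sym b) (high r)
  corner′-injective {inj₂ k} {inj₂ m} l b = cong inj₂ (Fin.toℕ-injective l)
  Inside′ : Pt′ → Rc′ → Set
  Inside′ p r = (left′ r ≤ X′ p × X′ p < right′ r) × (bottom′ r ≤ Y′ p × Y′ p < top′ r)
  sound′ : ∀ {p r} → (∃ λ e → e ∈ incidences × (p , r) ≡ f e) → Inside′ p r
  sound′ (_ , e∈ , refl) with (l , r) , bt ← sound e∈ = (+-monoʳ-≤ i l , +-monoʳ-< i r) , bt
  complete′ : ∀ {p r} → Inside′ p r → (p , r) ∈ map f incidences
  complete′ {inj₁ p} {inj₁ r} ((l , r′) , bt) =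
    ∈-map⁺ f (complete ((+-cancelˡ-≤ i _ _ l , +-cancelˡ-< i _ _ r′) , bt))
  complete′ {inj₁ p} {inj₂ k} (_ , b , t) = contradiction (<-trans (Y<height p) b) (<-irrefl refl)
  complete′ {inj₂ k} {inj₁ r} (_ , b , t) = contradiction (top≤height r) (<⇒≱ t)
  complete′ {inj₂ k} {inj₂ m} (_ , b , t) = contradiction b (<-irrefl refl)

-- Rational configurations

-- The reduced fraction is given directly, so that injectivity holds by unification.
ι : ℕ → ℚ
ι k = mkℚ (ℤ.+ k) 0 (coprime-sym (1-coprimeTo k))

ι-mono-< : ∀ {m n} → m < n → ι m ℚ.< ι n
ι-mono-< {m} {n} m<n =
  *<* (subst₂ ℤ._<_ (sym (ℤ.*-identityʳ (ℤ.+ m))) (sym (ℤ.*-identityʳ (ℤ.+ n))) (ℤ.+<+ m<n))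

ι-cancel-< : ∀ {m n} → ι m ℚ.< ι n → m < n
ι-cancel-< {m} {n} h =
  ℤ.drop‿+<+ (subst₂ ℤ._<_ (ℤ.*-identityʳ (ℤ.+ m)) (ℤ.*-identityʳ (ℤ.+ n)) (drop-*<* h))

ι-injective : ∀ {m n} → ι m ≡ ι n → m ≡ n
ι-injective refl = refl

-- An integer x lies in [a, c) iff the odd number 2x + 1 lies in the open interval (2a, 2c).
module _ {a c x : ℕ} where

  open-interval : a ≤ x × x < c → ι (2 * a) ℚ.< ι (suc (2 * x)) × ι (suc (2 * x)) ℚ.< ι (2 * c)
  open-interval (a≤x , x<c) =
    ι-mono-< (s≤s (*-monoʳ-≤ 2 a≤x)) ,
    ι-mono-< (≤-trans (≤-reflexive (sym (*-suc 2 x))) (*-monoʳ-≤ 2 x<c))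

  open-interval⁻ : ι (2 * a) ℚ.< ι (suc (2 * x)) × ι (suc (2 * x)) ℚ.< ι (2 * c) → a ≤ x × x < c
  open-interval⁻ (l , r) =
    *-cancelˡ-≤ 2 (s≤s⁻¹ (ι-cancel-< l)) , *-cancelˡ-< 2 x c (<-trans (n<1+n (2 * x)) (ι-cancel-< r))


-- `edges` is the length of the row-by-row list of all incident pairs, which contains all of `L`.
unique-incidences≤edges : ∀ {n} (C : Config n) {L} → Unique L →
  (∀ {i j} → (i , j) ∈ L → pt C i ∈R rc C j) → length L ≤ edges C
unique-incidences≤edges {n} C L! inc = ≤-trans (unique-⊆⇒length≤ L! sub) (≤-reflexive (count (allFin n)))
  where
  row : Fin n → List (Fin n)
  row i = filter (λ j → pt C i ∈R? rc C j) (allFin n)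
  pairs : Fin n → List (Fin n × Fin n)
  pairs i = map (i ,_) (row i)
  sub : ∀ {e} → e ∈ _ → e ∈ concatMap pairs (allFin n)
  sub {i , j} e∈ = ∈-concatMap⁺ pairs (Any.map (λ { refl →
    ∈-map⁺ (i ,_) (∈-filter⁺ (λ j → pt C i ∈R? rc C j) (∈-allFin j) (inc e∈)) }) (∈-allFin i))
  count : ∀ is → length (concatMap pairs is) ≡ sum (map (length ∘ row) is)
  count []       = refl
  count (i ∷ is) = trans (length-++ (pairs i)) (cong₂ _+_ (length-map (i ,_) (row i)) (count is))

-- A repeated edge would join vertices already connected by a walk of one edge.
highGirth⇒unique : ∀ {A B : Set} {g} {es : List (A × B)} → 1 ≤ g → HighGirth g es → Unique es
highGirth⇒unique 1≤g [] = []
highGirth⇒unique {g = suc g} 1≤g (_∷_ {es = es} ¬w hg) =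
  All.tabulate (λ i eq → ¬w (across (subst (_∈ es) (sym eq) i) done)) ∷ highGirth⇒unique 1≤g hg

module _ {g n E : ℕ} (1≤g : 1 ≤ g) (𝒜 : Arrangement g n n E) where

  open Arrangement 𝒜
  private
    module Pt↔ = Inverse pts
    module Rc↔ = Inverse rcs

  to-injective : ∀ {A B : Set} (f : A ↔ B) {x y} → Inverse.to f x ≡ Inverse.to f y → x ≡ y
  to-injective f = Injection.injective (↔⇒↣ f)

  point : Pt → Point
  point p = ι (suc (2 * X p)) , ι (suc (2 * Y p))

  rectangle : Rc → Rect
  rectangle r = rect (ι (2 * left r)) (ι (2 * bottom r)) (ι (2 * right r)) (ι (2 * top r))

  inside⇒∈R : ∀ {p r} → Inside p r → point p ∈R rectangle r
  inside⇒∈R = Product.map open-interval open-interval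

  ∈R⇒inside : ∀ {p r} → point p ∈R rectangle r → Inside p r
  ∈R⇒inside = Product.map open-interval⁻ open-interval⁻

  -- The corner cell of one rectangle lies in the other one, so their corners agree.
  corner-≤ : ∀ r s → SameSet (rectangle r) (rectangle s) → left s ≤ left r × bottom s ≤ bottom r
  corner-≤ r s same
    with x , y ← proj₁ (same (ι (suc (2 * left r)) , ι (suc (2 * bottom r))))
                       (open-interval (≤-refl , left<right r) , open-interval (≤-refl , bottom<top r)) =
    proj₁ (open-interval⁻ {c = right s} x) , proj₁ (open-interval⁻ {c = top s} y)

  config : Config n
  config = record
    { pt = point ∘ Pt↔.to
    ; rc = rectangle ∘ Rc↔.to
    ; pt-inj = λ eq → to-injective pts (X-injective
        (*-cancelˡ-≡ _ _ 2 (suc-injective (ι-injective (cong proj₁ eq)))))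
    ; rc-distinct = λ i j i≢j same →
        let r = Rc↔.to i ; s = Rc↔.to j
            l , b   = corner-≤ r s same
            l′ , b′ = corner-≤ s r (λ p → Product.swap (same p))
        in i≢j (to-injective rcs (corner-injective (≤-antisym l′ l) (≤-antisym b′ b)))
    }

  config-girth : GirthAtLeast config g
  config-girth k 1≤k cycle = <⇒≤ (no-short-cycle k (Pt↔.to ∘ ps) (Rc↔.to ∘ rs) girth
    (ps-inj ∘ to-injective pts) (rs-inj ∘ to-injective rcs)
    (λ i → complete (∈R⇒inside (inc-here i))) (λ i → complete (∈R⇒inside (inc-next i)))
    (complete (∈R⇒inside inc-close)) 1≤k)
    where open Cycle cycle

  config-edges : E ≤ edges config
  config-edges = ≤-trans (≤-reflexive (trans (sym size) (sym (length-map f incidences))))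
    (unique-incidences≤edges config (Unique.map⁺ f-injective (highGirth⇒unique 1≤g girth)) incident)
    where
    f : Pt × Rc → Fin n × Fin n
    f = Product.map Pt↔.from Rc↔.from
    f-injective : ∀ {x y} → f x ≡ f y → x ≡ y
    f-injective eq =
      cong₂ _,_ (to-injective (↔-sym pts) (cong proj₁ eq)) (to-injective (↔-sym rcs) (cong proj₂ eq))
    incident : ∀ {i j} → (i , j) ∈ map f incidences → point (Pt↔.to i) ∈R rectangle (Rc↔.to j)
    incident i∈ with (p , r) , e∈ , refl ← ∈-map⁻ f i∈ =
      inside⇒∈R (subst₂ Inside (sym (Pt↔.strictlyInverseˡ p)) (sym (Rc↔.strictlyInverseˡ r)) (sound e∈))

-- Growth of the construction

n<2^n : ∀ n → n < 2 ^ n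
n<2^n zero    = z<s
n<2^n (suc n) = begin-strict
  suc n         ≤⟨ n<2^n n ⟩
  2 ^ n         <⟨ m<m+n (2 ^ n) (≤-trans (s≤s z≤n) (≤-trans (n<2^n n) (m≤m+n (2 ^ n) 0))) ⟩
  2 * 2 ^ n     ∎
  where open ≤-Reasoning

threshold : ℕ → ℕ → ℕ
threshold g P = 2 * suc (2 * P) ^ g

-- The slack in `2 + R ≤ P` pays for the columns: of the `N * (2 + R)` available, `N * R + N` are
-- used and the other `N ≥ 2` restore the slack. `M` is left free so that the last step can be
-- fitted to `n`.
advance : ∀ {g D P R M} → Arrangement g P R (suc D * P) → 2 + R ≤ P → threshold g P < M →
          ∃ λ R′ → 2 + R′ ≤ P * M * P × Arrangement g (P * M * P) R′ ((2 + D) * (P * M * P))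
advance {g} {D} {P} {R} {M} 𝒜 R<P small =
  N * R + N , bound , subst (Arrangement g (N * P) (N * R + N)) (edge-count N P D) (Step.step 𝒜 small)
  where
  instance
    P≢0 : NonZero P
    P≢0 = >-nonZero (≤-trans (s≤s z≤n) R<P)
  N = P * M
  edge-count : ∀ N P D → N * P + N * (suc D * P) ≡ (2 + D) * (N * P)
  edge-count = solve-∀
  rearrange : ∀ N R → N + (N * R + N) ≡ N * (2 + R)
  rearrange = solve-∀
  bound : 2 + (N * R + N) ≤ N * P
  bound = begin
    2 + (N * R + N) ≤⟨ +-monoˡ-≤ (N * R + N) (*-mono-≤ (≤-trans (m≤m+n 2 R) R<P) (≤-trans (s≤s z≤n) small)) ⟩
    N + (N * R + N) ≡⟨ rearrange N R ⟩
    N * (2 + R)     ≤⟨ *-monoʳ-≤ N R<P ⟩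
    N * P           ∎
    where open ≤-Reasoning

module _ (g : ℕ) where

  width : ℕ → ℕ
  -- With one rectangle, the invariant `2 + R ≤ P` asks for three points.
  width zero    = 3
  width (suc D) = width D * suc (threshold g (width D)) * width D

  tower : ∀ D → ∃ λ R → 2 + R ≤ width D × Arrangement g (width D) R (suc D * width D)
  tower zero    = 1 , ≤-refl , base g 3
  tower (suc D) with _ , R<P , 𝒜 ← tower D = advance {g} {D} 𝒜 R<P ≤-refl

  3≤width : ∀ D → 3 ≤ width D
  3≤width zero    = ≤-refl
  3≤width (suc D) = *-mono-≤ {1} (*-mono-≤ {1} {u = 1} (≤-trans (s≤s z≤n) (3≤width D)) (s≤s z≤n)) (3≤width D)

  D<width : ∀ D → D < width D
  D<width zero    = s≤s z≤n
  D<width (suc D) = begin-strict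
    suc D         ≤⟨ D<width D ⟩
    width D       <⟨ m<m+n (width D) (≤-trans (s≤s z≤n) (≤-trans (3≤width D) (m≤m+n (width D) 0))) ⟩
    2 * width D   ≤⟨ *-monoˡ-≤ (width D) (*-mono-≤ (≤-trans (s≤s (s≤s z≤n)) (3≤width D)) (s≤s z≤n)) ⟩
    width (suc D) ∎
    where open ≤-Reasoning

  -- The search descends from stage `suc n`, whose width exceeds `n`. In the second case stage `D`
  -- leaves room for one more step within `n` points.
  locate : ∀ n → n < width 1 ⊎ ∃ λ D → width (suc D) ≤ n × n < width (2 + D)
  locate n = search n (<-trans (n<1+n n) (D<width (suc n)))
    where
    search : ∀ m → n < width (suc m) → n < width 1 ⊎ ∃ λ D → width (suc D) ≤ n × n < width (2 + D)
    search zero    n< = inj₁ n<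
    search (suc m) n< with width (suc m) ≤? n
    ... | yes ≤n = inj₂ (m , ≤n , n<)
    ... | no ≰n  = search m (≰⇒> ≰n)

  -- A step raises the width at most to this power: `suc (2 * P) ^ g` costs `2 * g`, the factor 2
  -- and the successors cost one more, and the outer factors `P` cost two.
  exponent : ℕ
  exponent = 3 + 2 * g

  next-width≤ : ∀ P → 3 ≤ P → P * suc (threshold g P) * P ≤ P ^ exponent
  next-width≤ P 3≤P = begin
    P * suc (2 * suc (2 * P) ^ g) * P ≤⟨ *-monoˡ-≤ P (*-monoʳ-≤ P inner) ⟩
    P * (P * P ^ (2 * g)) * P         ≡⟨ *-comm (P * (P * P ^ (2 * g))) P ⟩
    P ^ exponent                      ∎
    where
    open ≤-Reasoning
    Q = P ^ (2 * g)
    1+2P≤P² : suc (2 * P) ≤ P ^ 2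
    1+2P≤P² = begin
      suc (2 * P) ≤⟨ +-monoˡ-≤ (2 * P) (≤-trans (s≤s z≤n) 3≤P) ⟩
      3 * P       ≤⟨ *-monoˡ-≤ P 3≤P ⟩
      P * P       ≡⟨ cong (P *_) (*-identityʳ P) ⟨
      P ^ 2       ∎
    inner : suc (2 * suc (2 * P) ^ g) ≤ P * Q
    inner = begin
      suc (2 * suc (2 * P) ^ g) ≤⟨ s≤s (*-monoʳ-≤ 2 (^-monoˡ-≤ g 1+2P≤P²)) ⟩
      suc (2 * (P ^ 2) ^ g)     ≡⟨ cong (λ q → suc (2 * q)) (^-*-assoc P 2 g) ⟩
      suc (2 * Q)               ≤⟨ +-monoˡ-≤ (2 * Q) (m^n>0 P {{>-nonZero (≤-trans (s≤s z≤n) 3≤P)}} (2 * g)) ⟩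
      3 * Q                     ≤⟨ *-monoˡ-≤ Q 3≤P ⟩
      P * Q                     ∎

  -- Raising to the power `f ≤ 2 ^ f` adds at most `f` to the iterated logarithm.
  width≤ : ∀ D → width D ≤ 2 ^ 2 ^ (1 + exponent * D)
  width≤ zero    = subst (λ e → 3 ≤ 2 ^ 2 ^ suc e) (sym (*-zeroʳ exponent)) (s≤s (s≤s (s≤s z≤n)))
  width≤ (suc D) = begin
    width (suc D)                             ≤⟨ next-width≤ (width D) (3≤width D) ⟩
    width D ^ f
      ≤⟨ ^-monoʳ-≤ (width D) {{>-nonZero (≤-trans (s≤s z≤n) (3≤width D))}} (<⇒≤ (n<2^n f)) ⟩
    width D ^ 2 ^ f                           ≤⟨ ^-monoˡ-≤ (2 ^ f) (width≤ D) ⟩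
    (2 ^ 2 ^ (1 + f * D)) ^ 2 ^ f             ≡⟨ ^-*-assoc 2 (2 ^ (1 + f * D)) (2 ^ f) ⟩
    2 ^ (2 ^ (1 + f * D) * 2 ^ f)             ≡⟨ cong (2 ^_) (^-distribˡ-+-* 2 (1 + f * D) f) ⟨
    2 ^ 2 ^ (1 + f * D + f)
      ≡⟨ cong (λ e → 2 ^ 2 ^ suc e) (trans (+-comm (f * D) f) (sym (*-suc f D))) ⟩
    2 ^ 2 ^ (1 + f * suc D)                   ∎
    where
    open ≤-Reasoning
    f = exponent

  loglog≤ : ∀ {n} D → n < width (suc D) → ⌊log₂ ⌈log₂ n ⌉ ⌋ ≤ suc exponent * suc D
  loglog≤ {n} D n<width = begin
    ⌊log₂ ⌈log₂ n ⌉ ⌋             ≤⟨ ⌊log₂⌋-mono-≤ (⌈log₂⌉-mono-≤ (≤-trans (<⇒≤ n<width) (width≤ (suc D)))) ⟩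
    ⌊log₂ ⌈log₂ 2 ^ 2 ^ e ⌉ ⌋     ≡⟨ cong ⌊log₂_⌋ (⌈log₂2^n⌉≡n (2 ^ e)) ⟩
    ⌊log₂ 2 ^ e ⌋                 ≡⟨ ⌊log₂[2^n]⌋≡n e ⟩
    1 + exponent * suc D          ≤⟨ +-monoˡ-≤ (exponent * suc D) (s≤s z≤n) ⟩
    suc exponent * suc D          ∎
    where
    open ≤-Reasoning
    e = 1 + exponent * suc D

  -- The factor 2 is lost in padding, where `n ≤ 2 * P`; the other one comes from `loglog≤`.
  constant : ℕ
  constant = 2 * suc exponent

  Goal : ℕ → Set
  Goal n = Σ (Config n) λ C → GirthAtLeast C g × n * ⌊log₂ ⌈log₂ n ⌉ ⌋ ≤ constant * edges C

  -- Configurations with exactly `n` points and `n` rectangles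

  module _ (1≤g : 1 ≤ g) where

    conclude : ∀ {n P R} D → P ≤ n → R ≤ n → n ≤ 2 * P → n < width (suc D) →
               Arrangement g P R (suc D * P) → Goal n
    conclude {n} {P} {R} D P≤n R≤n n≤2P n<width 𝒜 =
      config 1≤g 𝒜′ , config-girth 1≤g 𝒜′ , bound
      where
      open ≤-Reasoning
      𝒜′ : Arrangement g n n (suc D * P)
      𝒜′ = subst₂ (λ p r → Arrangement g p r (suc D * P)) (m+[n∸m]≡n P≤n) (m+[n∸m]≡n R≤n)
                  (pad (n ∸ P) (n ∸ R) 𝒜)
      rearrange : ∀ P c d → 2 * P * (c * d) ≡ 2 * c * (d * P)
      rearrange = solve-∀
      bound : n * ⌊log₂ ⌈log₂ n ⌉ ⌋ ≤ constant * edges (config 1≤g 𝒜′)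
      bound = begin
        n * ⌊log₂ ⌈log₂ n ⌉ ⌋               ≤⟨ *-mono-≤ n≤2P (loglog≤ D n<width) ⟩
        2 * P * (suc exponent * suc D)      ≡⟨ rearrange P (suc exponent) (suc D) ⟩
        constant * (suc D * P)              ≤⟨ *-monoʳ-≤ constant (config-edges 1≤g 𝒜′) ⟩
        constant * edges (config 1≤g 𝒜′)    ∎

    goal : ∀ n → 1 ≤ n → Goal n
    goal n 1≤n with locate n
    ... | inj₁ n<width =
      conclude 0 ≤-refl 1≤n (m≤m+n n (n + 0)) n<width
        (subst (Arrangement g n 1) (sym (*-identityˡ n)) (base g n))
    ... | inj₂ (D , width≤n , n<width) with R , R<P , 𝒜 ← tower D =
      let R′ , R′<P′ , 𝒜′ = advance {g} {D} 𝒜 R<P small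
      in conclude (suc D) P′≤n (≤-trans (m≤n+m R′ 2) (≤-trans R′<P′ P′≤n)) n≤2P′ n<width 𝒜′
      where
      open ≤-Reasoning
      P = width D
      instance
        P²≢0 : NonZero (P * P)
        P²≢0 = >-nonZero (*-mono-≤ {1} {u = 1} (≤-trans (s≤s z≤n) (3≤width D)) (≤-trans (s≤s z≤n) (3≤width D)))
      -- The last step takes the largest `M` with `P * M * P ≤ n`. It misses `n` by less than
      -- `P * P`, which is at most `P * M * P`, and `width (suc D) ≤ n` puts `M` above the
      -- threshold.
      M = n / (P * P)
      xyx≡yxx : ∀ x y → x * y * x ≡ y * (x * x)
      xyx≡yxx = solve-∀
      small : threshold g P < M
      small = begin
        suc (threshold g P)                     ≡⟨ m*n/n≡m (suc (threshold g P)) (P * P) ⟨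
        suc (threshold g P) * (P * P) / (P * P)
          ≤⟨ /-monoˡ-≤ (P * P) (≤-trans (≤-reflexive (sym (xyx≡yxx P (suc (threshold g P))))) width≤n) ⟩
        M                                       ∎
      P′≤n : P * M * P ≤ n
      P′≤n = ≤-trans (≤-reflexive (xyx≡yxx P M)) (m/n*n≤m n (P * P))
      double : ∀ P M → M * (P * P) + M * (P * P) ≡ 2 * (P * M * P)
      double = solve-∀
      n≤2P′ : n ≤ 2 * (P * M * P)
      n≤2P′ = begin
        n                             ≡⟨ m≡m%n+[m/n]*n n (P * P) ⟩
        n % (P * P) + M * (P * P)     ≤⟨ +-monoˡ-≤ (M * (P * P)) (<⇒≤ (m%n<n n (P * P))) ⟩
        P * P + M * (P * P)           ≡⟨ cong (_+ M * (P * P)) (*-identityˡ (P * P)) ⟨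
        1 * (P * P) + M * (P * P)
          ≤⟨ +-monoˡ-≤ (M * (P * P)) (*-monoˡ-≤ (P * P) (≤-trans (s≤s z≤n) small)) ⟩
        M * (P * P) + M * (P * P)     ≡⟨ double P M ⟩
        2 * (P * M * P)               ∎

theorem5p3 : (g : ℕ) → 1 ≤ g →
    Σ ℕ (λ K → 1 ≤ K × ((n : ℕ) → 1 ≤ n →
    Σ (Config n) (λ G → GirthAtLeast G g × n * ⌊log₂ ⌈log₂ n ⌉ ⌋ ≤ K * edges G)))
theorem5p3 g 1≤g = constant g , s≤s z≤n , goal g 1≤g
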